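{- Let $\mathbb{K}$ be a field and $s\geq 3$ an integer. Let $f=\sum_{i=0}^n a_ix_s^i\in\mathbb{K}[x_1,\ldots,x_s]$ with $n\geq 2$, $a_0,\ldots,a_{n-1}\in\mathbb{K}[x_1,\ldots,x_{s-1}]$, $a_n\in\mathbb{K}[x_1,\ldots,x_{s-2}]$, $a_0a_n\neq 0$, and assume there exists an index $j$ with $0\leq j\leq n-1$ such that $\deg_{s-1}a_j>\max_{i\neq j}\deg_{s-1}a_i$. Then $f$ is a product of at most $n-j$ irreducible polynomials over $\mathbb{K}[x_1,\ldots,x_{s-1}]$. In particular, if $j=n-1$, then $f$ is irreducible over $\mathbb{K}[x_1,\ldots,x_{s-1}]$.
   Context: For a polynomial $g\in\mathbb{K}[x_1,\ldots,x_r]$, $\deg_r g$ denotes the degree of $g$ viewed as a polynomial in $x_r$ with coefficients in $\mathbb{K}[x_1,\ldots,x_{r-1}]$. $f$ is regarded as a polynomial in $x_s$ with coefficients in $\mathbb{K}[x_1,\ldots,x_{s-1}]$, and "a product of at most $k$ irreducible polynomials over $\mathbb{K}[x_1,\ldots,x_{s-1}]$" means that its factorization into irreducibles of $\mathbb{K}[x_1,\ldots,x_{s-1}][x_s]$ has at most $k$ factors counted with multiplicities.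
   Formalization: The bound n-j counts only irreducible factors of positive degree in x_s (all factors if f is primitive), and irreducibility for j=n-1 ignores factors free of x_s unless f is primitive; K has decidable equality and existence of a factorization is doubly negated. -}

module Defs where

open import Algebra.Bundles using (CommutativeRing; CommutativeSemigroup; Semiring)
open import Algebra.Structures using (IsCommutativeMonoid; IsCommutativeRing)
import Algebra.Definitions.RawSemiring as RawSemiringDefinitions
import Algebra.Properties.CommutativeSemigroup as CommutativeSemigroupProperties
import Algebra.Properties.Ring as RingProperties
open import Data.List.Base using (List; []; _∷_; foldr; map)
open import Data.List.Relation.Unary.All using (All)
open import Data.Nat.Base using (ℕ; zero; suc; _<_)
open import Data.Nat.Properties using (_<?_)
open import Data.Product.Base using (∃; _×_; _,_)
open import Data.Sum.Base using (_⊎_)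
open import Level using (_⊔_) renaming (suc to lsuc)
open import Relation.Binary.Bundles using (Setoid)
open import Relation.Binary.Construct.Add.Infimum.Strict _<_ using (_<₋_; <₋-dec)
open import Relation.Binary.Definitions using (Decidable)
open import Relation.Binary.Structures using (IsEquivalence)
import Relation.Binary.Reasoning.Setoid as SetoidReasoning
open import Relation.Nullary using (¬_; yes; no)
import Relation.Nullary.Decidable as Dec
open import Relation.Nullary.Construct.Add.Infimum using (_₋; ⊥₋; [_])
import Relation.Unary as U

record DecCommutativeRing c ℓ : Set (lsuc (c ⊔ ℓ)) where
  field
    commutativeRing : CommutativeRing c ℓ
  open CommutativeRing commutativeRing public
  open Semiring semiring public using (rawSemiring)
  field
    _≟_ : Decidable _≈_

-- Decidable equality is the usual constructive reading of "field"
-- (a discrete field); classically it is no restriction.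
record Field c ℓ : Set (lsuc (c ⊔ ℓ)) where
  field
    decCommutativeRing : DecCommutativeRing c ℓ
  open DecCommutativeRing decCommutativeRing public
  field
    1≉0     : 1# ≉ 0#
    inverse : ∀ x → x ≉ 0# → ∃ λ y → x * y ≈ 1#

-- Univariate polynomials over R: the list a₀ ∷ a₁ ∷ … stands for
-- a₀ + a₁X + ⋯.  Trailing zeros are allowed, so equality is equality of
-- all coefficients.
module Poly {c ℓ} (R : DecCommutativeRing c ℓ) where

  private
    module R = DecCommutativeRing R
    module RP = RingProperties R.ring
  open R using (_≈_; _≟_; 0#; 1#) renaming (Carrier to A)

  infixl 6 _+ₚ_
  infixl 7 _*ₚ_
  infixr 8 _·_
  infix  4 _≋_

  coeff : List A → ℕ → A
  coeff []      _       = 0#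
  coeff (a ∷ p) zero    = a
  coeff (a ∷ p) (suc i) = coeff p i

  record _≋_ (p q : List A) : Set ℓ where
    constructor mk≋
    field
      coeff-≈ : ∀ i → coeff p i ≈ coeff q i
  open _≋_ public

  _+ₚ_ : List A → List A → List A
  []      +ₚ q       = q
  (a ∷ p) +ₚ []      = a ∷ p
  (a ∷ p) +ₚ (b ∷ q) = (a R.+ b) ∷ (p +ₚ q)

  -ₚ_ : List A → List A
  -ₚ_ = map (R.-_)

  _·_ : A → List A → List A
  a · p = map (a R.*_) p

  _*ₚ_ : List A → List A → List A
  []      *ₚ q = []
  (a ∷ p) *ₚ q = (a · q) +ₚ (0# ∷ (p *ₚ q))

  const : A → List A
  const a = a ∷ []

  X : List A
  X = 0# ∷ 1# ∷ []

  -- The degree of the zero polynomial is ⊥₋, i.e. -∞.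
  deg : List A → ℕ ₋
  deg [] = ⊥₋
  deg (a ∷ p) with deg p
  ... | [ d ] = [ suc d ]
  ... | ⊥₋ with a ≟ 0#
  ...   | yes _ = ⊥₋
  ...   | no  _ = [ 0 ]

  coeff-+ : ∀ p q i → coeff (p +ₚ q) i ≈ coeff p i R.+ coeff q i
  coeff-+ []      q       i       = R.sym (R.+-identityˡ _)
  coeff-+ (a ∷ p) []      i       = R.sym (R.+-identityʳ _)
  coeff-+ (a ∷ p) (b ∷ q) zero    = R.refl
  coeff-+ (a ∷ p) (b ∷ q) (suc i) = coeff-+ p q i

  coeff-neg : ∀ p i → coeff (-ₚ p) i ≈ R.- coeff p i
  coeff-neg []      i       = R.sym RP.-0#≈0#
  coeff-neg (a ∷ p) zero    = R.refl
  coeff-neg (a ∷ p) (suc i) = coeff-neg p i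

  coeff-· : ∀ a p i → coeff (a · p) i ≈ a R.* coeff p i
  coeff-· a []      i       = R.sym (R.zeroʳ a)
  coeff-· a (b ∷ p) zero    = R.refl
  coeff-· a (b ∷ p) (suc i) = coeff-· a p i

  ≋-isEquivalence : IsEquivalence _≋_
  ≋-isEquivalence = record
    { refl  = mk≋ λ _ → R.refl
    ; sym   = λ e → mk≋ λ i → R.sym (coeff-≈ e i)
    ; trans = λ e f → mk≋ λ i → R.trans (coeff-≈ e i) (coeff-≈ f i)
    }

  ≋-setoid : Setoid c ℓ
  ≋-setoid = record { isEquivalence = ≋-isEquivalence }

  open IsEquivalence ≋-isEquivalence
    renaming (refl to ≋-refl; sym to ≋-sym; trans to ≋-trans) using ()

  ∷-cong : ∀ {a b p q} → a ≈ b → p ≋ q → a ∷ p ≋ b ∷ q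
  ∷-cong a≈b p≋q = mk≋ λ { zero → a≈b ; (suc i) → coeff-≈ p≋q i }

  0∷[]≋[] : 0# ∷ [] ≋ []
  0∷[]≋[] = mk≋ λ { zero → R.refl ; (suc i) → R.refl }

  +ₚ-cong : ∀ {p p′ q q′} → p ≋ p′ → q ≋ q′ → p +ₚ q ≋ p′ +ₚ q′
  +ₚ-cong {p} {p′} {q} {q′} e f = mk≋ λ i → begin
    coeff (p +ₚ q) i           ≈⟨ coeff-+ p q i ⟩
    coeff p i R.+ coeff q i    ≈⟨ R.+-cong (coeff-≈ e i) (coeff-≈ f i) ⟩
    coeff p′ i R.+ coeff q′ i  ≈⟨ coeff-+ p′ q′ i ⟨
    coeff (p′ +ₚ q′) i         ∎
    where open SetoidReasoning R.setoid

  +ₚ-assoc : ∀ p q r → (p +ₚ q) +ₚ r ≋ p +ₚ (q +ₚ r)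
  +ₚ-assoc p q r = mk≋ λ i → begin
    coeff ((p +ₚ q) +ₚ r) i                      ≈⟨ coeff-+ (p +ₚ q) r i ⟩
    coeff (p +ₚ q) i R.+ coeff r i               ≈⟨ R.+-congʳ (coeff-+ p q i) ⟩
    (coeff p i R.+ coeff q i) R.+ coeff r i      ≈⟨ R.+-assoc _ _ _ ⟩
    coeff p i R.+ (coeff q i R.+ coeff r i)      ≈⟨ R.+-congˡ (coeff-+ q r i) ⟨
    coeff p i R.+ coeff (q +ₚ r) i               ≈⟨ coeff-+ p (q +ₚ r) i ⟨
    coeff (p +ₚ (q +ₚ r)) i                      ∎
    where open SetoidReasoning R.setoid

  +ₚ-comm : ∀ p q → p +ₚ q ≋ q +ₚ p
  +ₚ-comm p q = mk≋ λ i → begin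
    coeff (p +ₚ q) i         ≈⟨ coeff-+ p q i ⟩
    coeff p i R.+ coeff q i  ≈⟨ R.+-comm _ _ ⟩
    coeff q i R.+ coeff p i  ≈⟨ coeff-+ q p i ⟨
    coeff (q +ₚ p) i         ∎
    where open SetoidReasoning R.setoid

  +ₚ-identityʳ : ∀ p → p +ₚ [] ≋ p
  +ₚ-identityʳ []      = ≋-refl
  +ₚ-identityʳ (_ ∷ _) = ≋-refl

  -ₚ-cong : ∀ {p q} → p ≋ q → -ₚ p ≋ -ₚ q
  -ₚ-cong {p} {q} e = mk≋ λ i →
    R.trans (coeff-neg p i)
      (R.trans (R.-‿cong (coeff-≈ e i)) (R.sym (coeff-neg q i)))

  -ₚ-inverseˡ : ∀ p → (-ₚ p) +ₚ p ≋ []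
  -ₚ-inverseˡ p = mk≋ λ i →
    R.trans (coeff-+ (-ₚ p) p i)
      (R.trans (R.+-congʳ (coeff-neg p i)) (R.-‿inverseˡ _))

  +ₚ-isCommutativeMonoid : IsCommutativeMonoid _≋_ _+ₚ_ []
  +ₚ-isCommutativeMonoid = record
    { isMonoid = record
      { isSemigroup = record
        { isMagma = record
          { isEquivalence = ≋-isEquivalence ; ∙-cong = +ₚ-cong }
        ; assoc = +ₚ-assoc
        }
      ; identity = (λ _ → ≋-refl) , +ₚ-identityʳ
      }
    ; comm = +ₚ-comm
    }

  +ₚ-commutativeSemigroup : CommutativeSemigroup c ℓ
  +ₚ-commutativeSemigroup = record
    { isCommutativeSemigroup =
        IsCommutativeMonoid.isCommutativeSemigroup +ₚ-isCommutativeMonoid }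

  private
    module +S = CommutativeSemigroupProperties +ₚ-commutativeSemigroup

  ·-cong : ∀ {a b p q} → a ≈ b → p ≋ q → a · p ≋ b · q
  ·-cong {a} {b} {p} {q} a≈b p≋q = mk≋ λ i →
    R.trans (coeff-· a p i)
      (R.trans (R.*-cong a≈b (coeff-≈ p≋q i)) (R.sym (coeff-· b q i)))

  ·-distribˡ : ∀ a p q → a · (p +ₚ q) ≋ a · p +ₚ a · q
  ·-distribˡ a []      q       = ≋-refl
  ·-distribˡ a (b ∷ p) []      = ≋-refl
  ·-distribˡ a (b ∷ p) (d ∷ q) = ∷-cong (R.distribˡ a b d) (·-distribˡ a p q)

  ·-assoc : ∀ a b p → (a R.* b) · p ≋ a · (b · p)
  ·-assoc a b []      = ≋-refl
  ·-assoc a b (d ∷ p) = ∷-cong (R.*-assoc a b d) (·-assoc a b p)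

  0·p≋[] : ∀ p → 0# · p ≋ []
  0·p≋[] p = mk≋ λ i → R.trans (coeff-· 0# p i) (R.zeroˡ _)

  1·p≋p : ∀ p → 1# · p ≋ p
  1·p≋p p = mk≋ λ i → R.trans (coeff-· 1# p i) (R.*-identityˡ _)

  *ₚ-congˡ : ∀ p {q q′} → q ≋ q′ → p *ₚ q ≋ p *ₚ q′
  *ₚ-congˡ []      e = ≋-refl
  *ₚ-congˡ (a ∷ p) e =
    +ₚ-cong (·-cong R.refl e) (∷-cong R.refl (*ₚ-congˡ p e))

  *ₚ-zeroʳ : ∀ p → p *ₚ [] ≋ []
  *ₚ-zeroʳ []      = ≋-refl
  *ₚ-zeroʳ (a ∷ p) = ≋-trans (∷-cong R.refl (*ₚ-zeroʳ p)) 0∷[]≋[]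

  *ₚ-∷ʳ : ∀ p b q → p *ₚ (b ∷ q) ≋ b · p +ₚ (0# ∷ (p *ₚ q))
  *ₚ-∷ʳ []      b q = ≋-sym 0∷[]≋[]
  *ₚ-∷ʳ (a ∷ p) b q = ∷-cong (R.+-congʳ (R.*-comm a b)) (begin
    a · q +ₚ p *ₚ (b ∷ q)                 ≈⟨ +ₚ-cong ≋-refl (*ₚ-∷ʳ p b q) ⟩
    a · q +ₚ (b · p +ₚ (0# ∷ (p *ₚ q)))   ≈⟨ +S.x∙yz≈y∙xz (a · q) (b · p) _ ⟩
    b · p +ₚ (a · q +ₚ (0# ∷ (p *ₚ q)))   ∎)
    where open SetoidReasoning ≋-setoid

  *ₚ-comm : ∀ p q → p *ₚ q ≋ q *ₚ p
  *ₚ-comm []      q = ≋-sym (*ₚ-zeroʳ q)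
  *ₚ-comm (a ∷ p) q =
    ≋-trans (+ₚ-cong ≋-refl (∷-cong R.refl (*ₚ-comm p q))) (≋-sym (*ₚ-∷ʳ q a p))

  *ₚ-congʳ : ∀ {p p′} q → p ≋ p′ → p *ₚ q ≋ p′ *ₚ q
  *ₚ-congʳ {p} {p′} q e =
    ≋-trans (*ₚ-comm p q) (≋-trans (*ₚ-congˡ q e) (*ₚ-comm q p′))

  *ₚ-cong : ∀ {p p′ q q′} → p ≋ p′ → q ≋ q′ → p *ₚ q ≋ p′ *ₚ q′
  *ₚ-cong {p′ = p′} {q} e f = ≋-trans (*ₚ-congʳ q e) (*ₚ-congˡ p′ f)

  *ₚ-distribˡ : ∀ r p q → r *ₚ (p +ₚ q) ≋ r *ₚ p +ₚ r *ₚ q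
  *ₚ-distribˡ []      p q = ≋-refl
  *ₚ-distribˡ (a ∷ r) p q = begin
    a · (p +ₚ q) +ₚ (0# ∷ (r *ₚ (p +ₚ q)))
      ≈⟨ +ₚ-cong (·-distribˡ a p q)
           (∷-cong (R.sym (R.+-identityˡ 0#)) (*ₚ-distribˡ r p q)) ⟩
    (a · p +ₚ a · q) +ₚ ((0# ∷ (r *ₚ p)) +ₚ (0# ∷ (r *ₚ q)))
      ≈⟨ +S.interchange (a · p) (a · q) _ _ ⟩
    (a · p +ₚ (0# ∷ (r *ₚ p))) +ₚ (a · q +ₚ (0# ∷ (r *ₚ q)))
      ∎
    where open SetoidReasoning ≋-setoid

  *ₚ-distribʳ : ∀ r p q → (p +ₚ q) *ₚ r ≋ p *ₚ r +ₚ q *ₚ r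
  *ₚ-distribʳ r p q =
    ≋-trans (*ₚ-comm (p +ₚ q) r)
      (≋-trans (*ₚ-distribˡ r p q) (+ₚ-cong (*ₚ-comm r p) (*ₚ-comm r q)))

  ·-*ₚ-assoc : ∀ a p q → (a · p) *ₚ q ≋ a · (p *ₚ q)
  ·-*ₚ-assoc a []      q = ≋-refl
  ·-*ₚ-assoc a (b ∷ p) q = begin
    (a R.* b) · q +ₚ (0# ∷ ((a · p) *ₚ q))
      ≈⟨ +ₚ-cong (·-assoc a b q)
           (∷-cong (R.sym (R.zeroʳ a)) (·-*ₚ-assoc a p q)) ⟩
    a · (b · q) +ₚ a · (0# ∷ (p *ₚ q))
      ≈⟨ ·-distribˡ a (b · q) _ ⟨
    a · (b · q +ₚ (0# ∷ (p *ₚ q)))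
      ∎
    where open SetoidReasoning ≋-setoid

  *ₚ-assoc : ∀ p q r → (p *ₚ q) *ₚ r ≋ p *ₚ (q *ₚ r)
  *ₚ-assoc []      q r = ≋-refl
  *ₚ-assoc (a ∷ p) q r = begin
    (a · q +ₚ (0# ∷ (p *ₚ q))) *ₚ r
      ≈⟨ *ₚ-distribʳ r (a · q) _ ⟩
    (a · q) *ₚ r +ₚ (0# · r +ₚ (0# ∷ ((p *ₚ q) *ₚ r)))
      ≈⟨ +ₚ-cong (·-*ₚ-assoc a q r)
           (+ₚ-cong (0·p≋[] r) (∷-cong R.refl (*ₚ-assoc p q r))) ⟩
    a · (q *ₚ r) +ₚ (0# ∷ (p *ₚ (q *ₚ r)))
      ∎
    where open SetoidReasoning ≋-setoid

  *ₚ-identityˡ : ∀ p → const 1# *ₚ p ≋ p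
  *ₚ-identityˡ p =
    ≋-trans (+ₚ-cong (1·p≋p p) 0∷[]≋[]) (+ₚ-identityʳ p)

  isCommutativeRing : IsCommutativeRing _≋_ _+ₚ_ _*ₚ_ -ₚ_ [] (const 1#)
  isCommutativeRing = record
    { isRing = record
      { +-isAbelianGroup = record
        { isGroup = record
          { isMonoid = IsCommutativeMonoid.isMonoid +ₚ-isCommutativeMonoid
          ; inverse  = -ₚ-inverseˡ
                     , λ p → ≋-trans (+ₚ-comm p (-ₚ p)) (-ₚ-inverseˡ p)
          ; ⁻¹-cong  = -ₚ-cong
          }
        ; comm = +ₚ-comm
        }
      ; *-cong     = *ₚ-cong
      ; *-assoc    = *ₚ-assoc
      ; *-identity = *ₚ-identityˡ
                   , λ p → ≋-trans (*ₚ-comm p (const 1#)) (*ₚ-identityˡ p)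
      ; distrib    = *ₚ-distribˡ , *ₚ-distribʳ
      }
    ; *-comm = *ₚ-comm
    }

  ∷-≋? : ∀ {a b p q} → Dec.Dec (a ≈ b) → Dec.Dec (p ≋ q) → Dec.Dec (a ∷ p ≋ b ∷ q)
  ∷-≋? a≟b p≟q = Dec.map′
    (λ (a≈b , p≋q) → ∷-cong a≈b p≋q)
    (λ e → coeff-≈ e 0 , mk≋ λ i → coeff-≈ e (suc i))
    (a≟b Dec.×-dec p≟q)

  _≋?_ : Decidable _≋_
  []      ≋? []      = yes ≋-refl
  []      ≋? (b ∷ q) = Dec.map′ (≋-trans (≋-sym 0∷[]≋[])) (≋-trans 0∷[]≋[])
                         (∷-≋? (0# ≟ b) ([] ≋? q))
  (a ∷ p) ≋? []      = Dec.map′ (λ e → ≋-trans e 0∷[]≋[]) (λ e → ≋-trans e (≋-sym 0∷[]≋[]))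
                         (∷-≋? (a ≟ 0#) (p ≋? []))
  (a ∷ p) ≋? (b ∷ q) = ∷-≋? (a ≟ b) (p ≋? q)

  R[X] : DecCommutativeRing c ℓ
  R[X] = record
    { commutativeRing = record { isCommutativeRing = isCommutativeRing }
    ; _≟_             = _≋?_
    }

  open DecCommutativeRing R[X] using (rawSemiring)
  open RawSemiringDefinitions rawSemiring public using (sum; _^_; _∣_; Irreducible)

  Nonconstant : List A → Set
  Nonconstant p = [ 0 ] <₋ deg p

  nonconstant? : U.Decidable Nonconstant
  nonconstant? p = <₋-dec _<?_ [ 0 ] (deg p)

  IsFactorisation : List A → List (List A) → Set (c ⊔ ℓ)
  IsFactorisation f ps = All Irreducible ps × f ≋ foldr _*ₚ_ (const 1#) ps

  -- Irreducible as a polynomial in X, nonzero elements of R counting as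
  -- constants.  For nonconstant f, irreducibility in the ring R[X] is stronger:
  -- it also forbids a non-unit factor from R.  The two differ when R is not a
  -- field, e.g. for y(X² + zX + 1) over R = K[y,z].
  IrreducibleInX : List A → Set (c ⊔ ℓ)
  IrreducibleInX f =
    Nonconstant f × (∀ g h → f ≋ g *ₚ h → ¬ Nonconstant g ⊎ ¬ Nonconstant h)

  Primitive : List A → Set (c ⊔ ℓ)
  Primitive f = ∀ a → const a ∣ f → a ∣ᴿ 1#
    where open RawSemiringDefinitions R.rawSemiring using () renaming (_∣_ to _∣ᴿ_)

-- K[x₁,…,xₘ] = K[x₁,…,xₘ₋₁][xₘ]: Poly.deg, Poly.const and Poly.X over
-- Polynomials K m refer to the variable x₍ₘ₊₁₎.
Polynomials : ∀ {c ℓ} → Field c ℓ → ℕ → DecCommutativeRing c ℓ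
Polynomials K zero    = Field.decCommutativeRing K
Polynomials K (suc m) = Poly.R[X] (Polynomials K m)

{-# OPTIONS --safe #-}

-- Write y = xₛ₋₁ and x = xₛ.  For p ∈ R[y][x] let m be its x-degree and let k be
-- the x-degree of its leading coefficient with respect to y; over a domain both
-- are additive under products, and k ≤ m.  For f the latter coefficient is a
-- monomial in xʲ, so m − k = n − j.  A factor p of f with m > 0 has k < m: were
-- k = m, then p would attain its y-degree in its leading x-coefficient, which is
-- free of y, so p itself would be free of y and would divide a monomial c xʲ;
-- but p has a nonzero constant term since a₀ ≠ 0.  Hence every factor of positive
-- x-degree contributes at least 1 to n − j.
module Submission where

open import Defs
open import Algebra.Definitions.RawMagma using (_,_)
import Algebra.Definitions.RawSemiring as RawSemiringDefinitions
import Algebra.Properties.CommutativeSemigroup as CommutativeSemigroupProperties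
import Algebra.Properties.Semiring.Divisibility as SemiringDivisibility
open import Data.Fin.Base using (Fin; zero; suc; toℕ; fromℕ; fromℕ<; inject₁)
open import Data.Fin.Properties using (toℕ-fromℕ; toℕ-fromℕ<; toℕ-inject₁; toℕ<n; fromℕ≢inject₁)
open import Data.List.Base using (List; []; _∷_; _++_; length; filter; foldr; map; tabulate)
open import Data.List.Properties using (filter-all)
open import Data.List.Relation.Unary.All using (All; []; _∷_)
open import Data.List.Relation.Unary.All.Properties using (++⁺)
open import Data.Nat.Base using (ℕ; zero; suc; _+_; _∸_; _⊔_; _≤_; _<_; z≤n; s≤s; z<s)
import Data.Nat.Properties as ℕₚ
open import Data.Product.Base using (∃; _×_; _,_; proj₁; proj₂)
open import Data.Sum.Base using (_⊎_; inj₁; inj₂)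
open import Function.Base using (_∘_)
open import Level using () renaming (_⊔_ to _⊔ˡ_)
open import Relation.Binary.Construct.Add.Infimum.Strict _<_ using (_<₋_; [_])
open import Relation.Binary.PropositionalEquality
  using (_≡_; _≢_; refl; sym; trans; cong; cong₂; subst; module ≡-Reasoning)
import Relation.Binary.Reasoning.Setoid as SetoidReasoning
open import Relation.Nullary using (¬_; yes; no; contradiction)
open import Relation.Nullary.Construct.Add.Infimum using (_₋; ⊥₋; [_])

-- Domains, and irreducible factorisations from a logarithmic norm.

record IsDomain {c ℓ} (R : DecCommutativeRing c ℓ) : Set (c ⊔ˡ ℓ) where
  open DecCommutativeRing R renaming (trans to R-trans)
  field
    1≉0       : 1# ≉ 0#
    *-nonzero : ∀ {x y} → x ≉ 0# → y ≉ 0# → x * y ≉ 0#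

  *≉0⇒ˡ≉0 : ∀ {x y} → x * y ≉ 0# → x ≉ 0#
  *≉0⇒ˡ≉0 xy≉0 x≈0 = xy≉0 (R-trans (*-congʳ x≈0) (zeroˡ _))

  *≉0⇒ʳ≉0 : ∀ {x y} → x * y ≉ 0# → y ≉ 0#
  *≉0⇒ʳ≉0 xy≉0 y≈0 = xy≉0 (R-trans (*-congˡ y≈0) (zeroʳ _))

  *-cancel-0 : ∀ {x y} → x ≉ 0# → x * y ≈ 0# → y ≈ 0#
  *-cancel-0 {y = y} x≉0 xy≈0 with y ≟ 0#
  ... | yes y≈0 = y≈0
  ... | no  y≉0 = contradiction xy≈0 (*-nonzero x≉0 y≉0)

-- The size is a logarithmic norm: nonunits have positive size, so it bounds the
-- number of factors and irreducible factorisations exist.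
record NormedDomain {c ℓ} (R : DecCommutativeRing c ℓ) : Set (c ⊔ˡ ℓ) where
  open DecCommutativeRing R hiding (_+_; sym; trans)
  open RawSemiringDefinitions rawSemiring using (_∣_; _∤_; Irreducible; mkIrred)
  private module R = DecCommutativeRing R
  field
    isDomain    : IsDomain R
    size        : Carrier → ℕ
    size-cong   : ∀ {x y} → x ≈ y → size x ≡ size y
    size-*      : ∀ {x y} → x ≉ 0# → y ≉ 0# → size (x * y) ≡ size x + size y
    size≡0⇒unit : ∀ {x} → x ≉ 0# → size x ≡ 0 → x ∣ 1#
  open IsDomain isDomain

  product : List Carrier → Carrier
  product = foldr _*_ 1#

  product-++ : ∀ xs ys → product (xs ++ ys) ≈ product xs * product ys
  product-++ []       ys = R.sym (*-identityˡ _)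
  product-++ (x ∷ xs) ys = R.trans (*-congˡ (product-++ xs ys)) (R.sym (*-assoc _ _ _))

  -- The double negation stands in for a decision whether `x` is irreducible. Suppose `x` has no
  -- factorisation. A splitting into two parts of positive size would factor by recursion on the
  -- size bound `k`, so every splitting has a part of size 0, hence a unit; then `x` is irreducible
  -- and is its own factorisation.
  factorise : ∀ k {x} → size x < k → x ≉ 0# → x ∤ 1# →
              ¬ ¬ ∃ λ xs → All Irreducible xs × x ≈ product xs
  factorise (suc k) {x} (s≤s |x|≤k) x≉0 x∤1 ¬factors =
    ¬factors (x ∷ [] , mkIrred x∤1 split ∷ [] , R.sym (*-identityʳ x))
    where
    split : ∀ {y z} → x ≈ y * z → y ∣ 1# ⊎ z ∣ 1#
    split {y} {z} x≈yz with size y ℕₚ.≟ 0 | size z ℕₚ.≟ 0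
    ... | yes |y|≡0 | _         = inj₁ (size≡0⇒unit y≉0 |y|≡0)
      where y≉0 = *≉0⇒ˡ≉0 (x≉0 ∘ R.trans x≈yz)
    ... | no  _     | yes |z|≡0 = inj₂ (size≡0⇒unit z≉0 |z|≡0)
      where z≉0 = *≉0⇒ʳ≉0 (x≉0 ∘ R.trans x≈yz)
    ... | no  |y|≢0 | no  |z|≢0 = contradiction
      (λ (ys , ys-irr , y≈) → factorise k |z|<k z≉0 z∤1
        λ (zs , zs-irr , z≈) → ¬factors
          (ys ++ zs , ++⁺ ys-irr zs-irr
          , R.trans x≈yz (R.trans (*-cong y≈ z≈) (R.sym (product-++ ys zs)))))
      (factorise k |y|<k y≉0 y∤1)
      where
      y≉0 = *≉0⇒ˡ≉0 (x≉0 ∘ R.trans x≈yz)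
      z≉0 = *≉0⇒ʳ≉0 (x≉0 ∘ R.trans x≈yz)
      |y|+|z|≤k : size y + size z ≤ k
      |y|+|z|≤k = subst (_≤ k) (trans (size-cong x≈yz) (size-* y≉0 z≉0)) |x|≤k
      |y|<k = ℕₚ.<-≤-trans (ℕₚ.m<m+n (size y) (ℕₚ.n≢0⇒n>0 |z|≢0)) |y|+|z|≤k
      |z|<k = ℕₚ.<-≤-trans (ℕₚ.m<n+m (size z) (ℕₚ.n≢0⇒n>0 |y|≢0)) |y|+|z|≤k
      size-1 : size 1# ≡ 0
      size-1 = ℕₚ.+-cancelˡ-≡ (size 1#) (size 1#) 0 (trans (sym (size-* 1≉0 1≉0))
        (trans (size-cong (*-identityˡ 1#)) (sym (ℕₚ.+-identityʳ _))))
      unit⇒size≡0 : ∀ {u} → u ∣ 1# → size u ≡ 0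
      unit⇒size≡0 {u} (v , vu≈1) = ℕₚ.m+n≡0⇒n≡0 (size v)
        (trans (sym (size-* (*≉0⇒ˡ≉0 vu≉0) (*≉0⇒ʳ≉0 vu≉0)))
          (trans (size-cong vu≈1) size-1))
        where
        vu≉0 : v * u ≉ 0#
        vu≉0 = 1≉0 ∘ R.trans (R.sym vu≈1)
      y∤1 = |y|≢0 ∘ unit⇒size≡0
      z∤1 = |z|≢0 ∘ unit⇒size≡0

-- Coefficients and degrees of univariate polynomials.

module PolyProperties {c ℓ} (R : DecCommutativeRing c ℓ) where

  private module R = DecCommutativeRing R
  open Poly R
  private module RX = DecCommutativeRing R[X]
  open SemiringDivisibility RX.semiring using (x∣y∧y≉0⇒x≉0)
  open RawSemiringDefinitions R.rawSemiring using () renaming (_∣_ to _∣ᴿ_)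

  Bounded : List R.Carrier → ℕ → Set ℓ
  Bounded p d = ∀ {i} → d < i → coeff p i R.≈ R.0#

  -- A relation on coefficients rather than an equation about `deg`: it transports along `_≋_` and
  -- does not see trailing zeros.
  record HasDegree (p : List R.Carrier) (d : ℕ) : Set ℓ where
    constructor mkDegree
    field
      leading≉0 : coeff p d R.≉ R.0#
      bounded   : Bounded p d
  open HasDegree public

  length-bounded : ∀ p → Bounded p (length p)
  length-bounded []      _         = R.refl
  length-bounded (a ∷ p) (s≤s d<i) = length-bounded p d<i

  coeff-∷+ : ∀ a p q i → coeff (a · p +ₚ (R.0# ∷ q)) (suc i) R.≈
             a R.* coeff p (suc i) R.+ coeff q i
  coeff-∷+ a p q i = R.trans (coeff-+ (a · p) (R.0# ∷ q) (suc i)) (R.+-congʳ (coeff-· a p (suc i)))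

  coeff-*ₚ-0 : ∀ p q → coeff (p *ₚ q) 0 R.≈ coeff p 0 R.* coeff q 0
  coeff-*ₚ-0 []      q = R.sym (R.zeroˡ _)
  coeff-*ₚ-0 (a ∷ p) q =
    R.trans (coeff-+ (a · q) _ 0) (R.trans (R.+-identityʳ _) (coeff-· a q 0))

  *ₚ-vanishes : ∀ p q → (∀ i → coeff p i R.≈ R.0#) → p *ₚ q ≋ []
  *ₚ-vanishes p q p≈0 = *ₚ-congʳ {p} {[]} q (mk≋ p≈0)

  -- The tail `p` vanishes, so the product is a scaling by `a`. This is the base case of the two
  -- inductions on the degree bound below.
  coeff-∷-*ₚ-const : ∀ a p q → Bounded (a ∷ p) 0 → ∀ i →
                     coeff ((a ∷ p) *ₚ q) i R.≈ a R.* coeff q i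
  coeff-∷-*ₚ-const a p q bdd i = begin
    coeff (a · q +ₚ (R.0# ∷ (p *ₚ q))) i             ≈⟨ coeff-+ (a · q) _ i ⟩
    coeff (a · q) i R.+ coeff (R.0# ∷ (p *ₚ q)) i    ≈⟨ R.+-cong (coeff-· a q i) (coeff-≈ 0∷pq≋[] i) ⟩
    a R.* coeff q i R.+ R.0#                         ≈⟨ R.+-identityʳ _ ⟩
    a R.* coeff q i                                  ∎
    where
    open SetoidReasoning R.setoid
    0∷pq≋[] : R.0# ∷ (p *ₚ q) ≋ []
    0∷pq≋[] = RX.trans (∷-cong R.refl (*ₚ-vanishes p q λ _ → bdd z<s)) 0∷[]≋[]

  *ₚ-bounded : ∀ p q {d e} → Bounded p d → Bounded q e → Bounded (p *ₚ q) (d + e)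
  *ₚ-bounded []      q _ _ _ = R.refl
  *ₚ-bounded (a ∷ p) q {zero} bp bq e<i =
    R.trans (coeff-∷-*ₚ-const a p q bp _) (R.trans (R.*-congˡ (bq e<i)) (R.zeroʳ a))
  *ₚ-bounded (a ∷ p) q {suc d} {e} bp bq {suc i} (s≤s d+e<i) = begin
    coeff ((a ∷ p) *ₚ q) (suc i)                      ≈⟨ coeff-∷+ a q _ i ⟩
    a R.* coeff q (suc i) R.+ coeff (p *ₚ q) i
      ≈⟨ R.+-cong (R.*-congˡ (bq e<1+i)) (*ₚ-bounded p q (bp ∘ s≤s) bq d+e<i) ⟩
    a R.* R.0# R.+ R.0#                               ≈⟨ R.+-identityʳ _ ⟩
    a R.* R.0#                                        ≈⟨ R.zeroʳ a ⟩
    R.0#                                              ∎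
    where
    open SetoidReasoning R.setoid
    e<1+i = s≤s (ℕₚ.≤-trans (ℕₚ.m≤n+m e d) (ℕₚ.<⇒≤ d+e<i))

  -- Here `d` and `e` are upper bounds and need not be attained. `yCoeff-*` relies on this: it
  -- applies the rule to all x-coefficients with common bounds.
  coeff-*ₚ-top : ∀ p q {d e} → Bounded p d → Bounded q e →
                 coeff (p *ₚ q) (d + e) R.≈ coeff p d R.* coeff q e
  coeff-*ₚ-top []      q _ _ = R.sym (R.zeroˡ _)
  coeff-*ₚ-top (a ∷ p) q {zero} bp bq = coeff-∷-*ₚ-const a p q bp _
  coeff-*ₚ-top (a ∷ p) q {suc d} {e} bp bq = begin
    coeff ((a ∷ p) *ₚ q) (suc (d + e))                      ≈⟨ coeff-∷+ a q _ (d + e) ⟩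
    a R.* coeff q (suc (d + e)) R.+ coeff (p *ₚ q) (d + e)
      ≈⟨ R.+-cong (R.*-congˡ (bq (s≤s (ℕₚ.m≤n+m e d)))) (coeff-*ₚ-top p q (bp ∘ s≤s) bq) ⟩
    a R.* R.0# R.+ coeff p d R.* coeff q e                  ≈⟨ R.+-congʳ (R.zeroʳ a) ⟩
    R.0# R.+ coeff p d R.* coeff q e                        ≈⟨ R.+-identityˡ _ ⟩
    coeff p d R.* coeff q e                                 ∎
    where open SetoidReasoning R.setoid

  HasDegree-resp-≋ : ∀ {p q d} → p ≋ q → HasDegree p d → HasDegree q d
  HasDegree-resp-≋ p≋q hp = mkDegree
    (λ q≈0 → leading≉0 hp (R.trans (coeff-≈ p≋q _) q≈0))
    (λ d<i → R.trans (R.sym (coeff-≈ p≋q _)) (bounded hp d<i))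

  coeff≉0⇒≤ : ∀ {p d i} → Bounded p d → coeff p i R.≉ R.0# → i ≤ d
  coeff≉0⇒≤ bp pᵢ≉0 = ℕₚ.≮⇒≥ λ d<i → pᵢ≉0 (bp d<i)

  HasDegree-unique : ∀ {p d e} → HasDegree p d → HasDegree p e → d ≡ e
  HasDegree-unique {p} hd he = ℕₚ.≤-antisym
    (coeff≉0⇒≤ {p} (bounded he) (leading≉0 hd)) (coeff≉0⇒≤ {p} (bounded hd) (leading≉0 he))

  HasDegree⇒≉0 : ∀ {p d} → HasDegree p d → ¬ p ≋ []
  HasDegree⇒≉0 hp p≋[] = leading≉0 hp (coeff-≈ p≋[] _)

  -- Connects the computed `deg` with the relation `HasDegree`; matching on `deg p` together with
  -- the view refines both at once.
  data DegreeView (p : List R.Carrier) : ℕ ₋ → Set (c ⊔ˡ ℓ) where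
    zeroPoly  : p ≋ [] → DegreeView p ⊥₋
    hasDegree : ∀ {d} → HasDegree p d → DegreeView p [ d ]

  degreeView : ∀ p → DegreeView p (deg p)
  degreeView [] = zeroPoly RX.refl
  degreeView (a ∷ p) with deg p | degreeView p
  ... | [ d ] | hasDegree hp = hasDegree (mkDegree (leading≉0 hp)
          λ { {suc _} (s≤s d<i) → bounded hp d<i })
  ... | ⊥₋    | zeroPoly p≋[] with a R.≟ R.0#
  ...   | yes a≈0 = zeroPoly (RX.trans (∷-cong a≈0 p≋[]) 0∷[]≋[])
  ...   | no  a≉0 = hasDegree (mkDegree a≉0 λ { {suc i} _ → coeff-≈ p≋[] i })

  ≉0⇒HasDegree : ∀ {p} → ¬ p ≋ [] → ∃ (HasDegree p)
  ≉0⇒HasDegree {p} p≉0 with deg p | degreeView p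
  ... | ⊥₋    | zeroPoly p≋[] = contradiction p≋[] p≉0
  ... | [ d ] | hasDegree hp  = d , hp

  HasDegree⇒deg≡ : ∀ {p d} → HasDegree p d → deg p ≡ [ d ]
  HasDegree⇒deg≡ {p} hp with deg p | degreeView p
  ... | ⊥₋    | zeroPoly p≋[] = contradiction p≋[] (HasDegree⇒≉0 hp)
  ... | [ _ ] | hasDegree hp′ = cong [_] (HasDegree-unique hp′ hp)

  <₋deg⇒HasDegree : ∀ {p x} → x <₋ deg p → ∃ (HasDegree p)
  <₋deg⇒HasDegree {p} x<p with deg p | degreeView p | x<p
  ... | [ d ] | hasDegree hp | _ = d , hp

  Nonconstant⇒≉0 : ∀ {p} → Nonconstant p → ¬ p ≋ []
  Nonconstant⇒≉0 nc = HasDegree⇒≉0 (proj₂ (<₋deg⇒HasDegree nc))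

  deg<⇒vanishes : ∀ {p d i} → deg p <₋ [ d ] → d ≤ i → coeff p i R.≈ R.0#
  deg<⇒vanishes {p} p<d d≤i with deg p | degreeView p | p<d
  ... | ⊥₋    | zeroPoly p≋[] | _       = coeff-≈ p≋[] _
  ... | [ _ ] | hasDegree hp  | [ e<d ] = bounded hp (ℕₚ.<-≤-trans e<d d≤i)

  positive⇒Nonconstant : ∀ {p d} → HasDegree p d → 0 < d → Nonconstant p
  positive⇒Nonconstant hp 0<d = subst ([ 0 ] <₋_) (sym (HasDegree⇒deg≡ hp)) [ 0<d ]

  Nonconstant⇒positive : ∀ {p d} → HasDegree p d → Nonconstant p → 0 < d
  Nonconstant⇒positive hp nc with [ 0<d ] ← subst ([ 0 ] <₋_) (HasDegree⇒deg≡ hp) nc = 0<d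

  ¬Nonconstant⇒degree-0 : ∀ {p} → ¬ p ≋ [] → ¬ Nonconstant p → HasDegree p 0
  ¬Nonconstant⇒degree-0 p≉0 ¬nc with ≉0⇒HasDegree p≉0
  ... | zero  , hp = hp
  ... | suc _ , hp = contradiction (positive⇒Nonconstant hp z<s) ¬nc

  bounded-0⇒≋const : ∀ {p} → Bounded p 0 → p ≋ const (coeff p 0)
  bounded-0⇒≋const bp = mk≋ λ { zero → R.refl ; (suc _) → bp z<s }

  const-unit : ∀ {p} → Bounded p 0 → coeff p 0 ∣ᴿ R.1# → p ∣ const R.1#
  const-unit {p} bp (u , u*p₀≈1) =
    const u , RX.trans (*ₚ-congˡ (const u) (bounded-0⇒≋const bp))
                       (∷-cong (R.trans (R.+-identityʳ _) u*p₀≈1) RX.refl)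

  const-∣ : ∀ {p f} → Bounded p 0 → p ∣ f → const (coeff p 0) ∣ f
  const-∣ bp (q , qp≋f) = q , RX.trans (*ₚ-congˡ q (RX.sym (bounded-0⇒≋const bp))) qp≋f

  X*ₚ : ∀ p → X *ₚ p ≋ R.0# ∷ p
  X*ₚ p = +ₚ-cong (0·p≋[] p) (∷-cong R.refl (*ₚ-identityˡ p))

  sum-0∷ : ∀ {m} {g h : Fin m → List R.Carrier} → (∀ i → g i ≋ R.0# ∷ h i) → sum g ≋ R.0# ∷ sum h
  sum-0∷ {zero}  g≋0∷h = RX.sym 0∷[]≋[]
  sum-0∷ {suc m} g≋0∷h = RX.trans (+ₚ-cong (g≋0∷h zero) (sum-0∷ (g≋0∷h ∘ suc)))
                                  (∷-cong (R.+-identityʳ _) RX.refl)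

  -- After the constant term is split off, every remaining term carries a factor `X`, and
  -- multiplication by `X` is a shift of the coefficient list.
  sum-monomials : ∀ {m} (a : Fin m → R.Carrier) →
                  sum (λ i → const (a i) *ₚ (X ^ toℕ i)) ≋ tabulate a
  sum-monomials {zero}  a = RX.refl
  sum-monomials {suc m} a = begin
    const (a zero) *ₚ const R.1# +ₚ sum (λ i → const (a (suc i)) *ₚ (X *ₚ (X ^ toℕ i)))
      ≈⟨ +ₚ-cong (RX.*-identityʳ (const (a zero))) (sum-0∷ shift) ⟩
    (a zero R.+ R.0#) ∷ sum (λ i → const (a (suc i)) *ₚ (X ^ toℕ i))
      ≈⟨ ∷-cong (R.+-identityʳ _) (sum-monomials (a ∘ suc)) ⟩
    a zero ∷ tabulate (a ∘ suc) ∎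
    where
    open SetoidReasoning ≋-setoid
    open CommutativeSemigroupProperties RX.*-commutativeSemigroup using (x∙yz≈y∙xz)
    shift : ∀ i → const (a (suc i)) *ₚ (X *ₚ (X ^ toℕ i)) ≋ R.0# ∷ (const (a (suc i)) *ₚ (X ^ toℕ i))
    shift i = RX.trans (x∙yz≈y∙xz (const (a (suc i))) X (X ^ toℕ i)) (X*ₚ _)

  coeff-tabulate : ∀ {m} (a : Fin m → R.Carrier) i → coeff (tabulate a) (toℕ i) ≡ a i
  coeff-tabulate a zero    = refl
  coeff-tabulate a (suc i) = coeff-tabulate (a ∘ suc) i

  coeff-tabulate-≥ : ∀ {m i} (a : Fin m → R.Carrier) → m ≤ i → coeff (tabulate a) i ≡ R.0#
  coeff-tabulate-≥ {zero}  a _         = refl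
  coeff-tabulate-≥ {suc m} a (s≤s m≤i) = coeff-tabulate-≥ (a ∘ suc) m≤i

  -- Polynomials over a domain.

  module _ (R-domain : IsDomain R) where
    open IsDomain R-domain

    HasDegree-*ₚ : ∀ {p q d e} → HasDegree p d → HasDegree q e → HasDegree (p *ₚ q) (d + e)
    HasDegree-*ₚ {p} {q} hp hq = mkDegree
      (λ top≈0 → *-nonzero (leading≉0 hp) (leading≉0 hq)
        (R.trans (R.sym (coeff-*ₚ-top p q (bounded hp) (bounded hq))) top≈0))
      (*ₚ-bounded p q (bounded hp) (bounded hq))

    1-degree : HasDegree (const R.1#) 0
    1-degree = mkDegree 1≉0 λ { {suc _} _ → R.refl }

    R[X]-isDomain : IsDomain R[X]
    R[X]-isDomain = record
      { 1≉0       = HasDegree⇒≉0 1-degree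
      ; *-nonzero = λ p≉0 q≉0 → HasDegree⇒≉0
          (HasDegree-*ₚ (proj₂ (≉0⇒HasDegree p≉0)) (proj₂ (≉0⇒HasDegree q≉0)))
      }

    -- The lowest nonzero coefficient of `q`, multiplied by the nonzero constant term of `p`, would
    -- survive in the product. The recursion strips one zero coefficient off `q` at a time.
    *ₚ-vanishes-below : ∀ p q {k} → coeff p 0 R.≉ R.0# →
                        (∀ {i} → i < k → coeff (p *ₚ q) i R.≈ R.0#) →
                        ∀ {i} → i < k → coeff q i R.≈ R.0#
    *ₚ-vanishes-below p [] p₀≉0 low i<k = R.refl
    *ₚ-vanishes-below p (b ∷ q) {suc k} p₀≉0 low = vanishes
      where
      b≈0 : b R.≈ R.0#
      b≈0 = *-cancel-0 p₀≉0 (R.trans (R.sym (coeff-*ₚ-0 p (b ∷ q))) (low z<s))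
      -- Once `b` is zero, the product with `b ∷ q` is the product with `q` shifted by one place.
      low′ : ∀ {i} → i < k → coeff (p *ₚ q) i R.≈ R.0#
      low′ {i} i<k = begin
        coeff (p *ₚ q) i                                 ≈⟨ R.+-identityˡ _ ⟨
        R.0# R.+ coeff (p *ₚ q) i                        ≈⟨ R.+-congʳ (R.trans (R.*-congʳ b≈0) (R.zeroˡ _)) ⟨
        b R.* coeff p (suc i) R.+ coeff (p *ₚ q) i       ≈⟨ coeff-∷+ b p _ i ⟨
        coeff (b · p +ₚ (R.0# ∷ (p *ₚ q))) (suc i)       ≈⟨ coeff-≈ (*ₚ-∷ʳ p b q) (suc i) ⟨
        coeff (p *ₚ (b ∷ q)) (suc i)                     ≈⟨ low (s≤s i<k) ⟩
        R.0#                                             ∎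
        where open SetoidReasoning R.setoid
      vanishes : ∀ {i} → i < suc k → coeff (b ∷ q) i R.≈ R.0#
      vanishes {zero}  _         = b≈0
      vanishes {suc i} (s≤s i<k) = *ₚ-vanishes-below p q p₀≉0 low′ i<k

    positive-degree⇒∤1 : ∀ {p d} → HasDegree p d → 0 < d → ¬ (p ∣ const R.1#)
    positive-degree⇒∤1 {p} {d} hp 0<d (q , qp≋1) = ℕₚ.n>0⇒n≢0 0<d (ℕₚ.m+n≡0⇒n≡0 (proj₁ hq)
      (HasDegree-unique (HasDegree-resp-≋ qp≋1 (HasDegree-*ₚ (proj₂ hq) hp)) 1-degree))
      where
      hq = ≉0⇒HasDegree (IsDomain.*≉0⇒ˡ≉0 R[X]-isDomain {q} {p}
             (IsDomain.1≉0 R[X]-isDomain ∘ RX.trans (RX.sym qp≋1)))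

  -- Factors of primitive polynomials.

  primitive-constantDivisor∣1 : ∀ {p f} → Primitive f → p ∣ f → ¬ p ≋ [] → ¬ Nonconstant p →
                                p ∣ const R.1#
  primitive-constantDivisor∣1 f-prim p∣f p≉0 ¬nc =
    const-unit p-bounded (f-prim _ (const-∣ p-bounded p∣f))
    where p-bounded = bounded (¬Nonconstant⇒degree-0 p≉0 ¬nc)

  -- A constant factor would be a unit by primitivity, which an irreducible is not. The hypothesis
  -- is divisibility of `f` by the product, so that the induction can move `p` into the cofactor.
  primitive-factors-nonconstant : ∀ {f} → Primitive f → ¬ f ≋ [] →
    ∀ ps → All Irreducible ps → foldr _*ₚ_ (const R.1#) ps ∣ f → All Nonconstant ps
  primitive-factors-nonconstant f-prim f≉0 [] [] _ = []
  primitive-factors-nonconstant {f} f-prim f≉0 (p ∷ ps) (p-irr ∷ ps-irr) (q , q*p*Π≋f) =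
    p-nonconstant ∷ primitive-factors-nonconstant f-prim f≉0 ps ps-irr
      (q *ₚ p , RX.trans (*ₚ-assoc q p Π) q*p*Π≋f)
    where
    Π = foldr _*ₚ_ (const R.1#) ps
    p∣f : p ∣ f
    p∣f = q *ₚ Π , RX.trans (*ₚ-assoc q Π p) (RX.trans (*ₚ-congˡ q (*ₚ-comm Π p)) q*p*Π≋f)
    p-nonconstant : Nonconstant p
    p-nonconstant with nonconstant? p
    ... | yes nc = nc
    ... | no ¬nc = contradiction
      (primitive-constantDivisor∣1 f-prim p∣f (x∣y∧y≉0⇒x≉0 p∣f f≉0) ¬nc)
      (RawSemiringDefinitions.Irreducible.p∤1 p-irr)

  primitive-IrreducibleInX⇒Irreducible : ∀ {f} → IsDomain R → Primitive f → IrreducibleInX f →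
                                         Irreducible f
  primitive-IrreducibleInX⇒Irreducible {f} R-domain f-prim (nc , split)
    with n , hf ← ≉0⇒HasDegree (Nonconstant⇒≉0 nc) =
    RawSemiringDefinitions.mkIrred (positive-degree⇒∤1 R-domain hf (Nonconstant⇒positive hf nc)) split∣1
    where
    unit : ∀ {p} → p ∣ f → ¬ Nonconstant p → p ∣ const R.1#
    unit p∣f = primitive-constantDivisor∣1 f-prim p∣f (x∣y∧y≉0⇒x≉0 p∣f (Nonconstant⇒≉0 nc))
    split∣1 : ∀ {g h} → f ≋ g *ₚ h → g ∣ const R.1# ⊎ h ∣ const R.1#
    split∣1 {g} {h} f≋gh with split g h f≋gh
    ... | inj₁ ¬nc = inj₁ (unit (h , RX.trans (*ₚ-comm h g) (RX.sym f≋gh)) ¬nc)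
    ... | inj₂ ¬nc = inj₂ (unit (g , RX.sym f≋gh) ¬nc)

  -- Norms on polynomial rings.

  R[X]-normedDomain : NormedDomain R → NormedDomain R[X]
  R[X]-normedDomain N = record
    { isDomain    = R[X]-isDomain R-domain
    ; size        = size
    ; size-cong   = size-cong
    ; size-*      = size-*
    ; size≡0⇒unit = size≡0⇒unit
    }
    where
    open NormedDomain N using () renaming (isDomain to R-domain)
    module N = NormedDomain N

    sizeAt : List R.Carrier → ℕ ₋ → ℕ
    -- A default value: additivity and the unit criterion concern nonzero elements only.
    sizeAt p ⊥₋    = 0
    -- Both summands are additive under products. A zero sum forces a constant polynomial whose
    -- coefficient has size 0, hence is a unit.
    sizeAt p [ d ] = d + N.size (coeff p d)

    size : List R.Carrier → ℕ
    size p = sizeAt p (deg p)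

    size-HasDegree : ∀ {p d} → HasDegree p d → size p ≡ d + N.size (coeff p d)
    size-HasDegree {p} hp = cong (sizeAt p) (HasDegree⇒deg≡ hp)

    size-cong : ∀ {p q} → p ≋ q → size p ≡ size q
    size-cong {p} {q} p≋q with deg p | degreeView p | deg q | degreeView q
    ... | ⊥₋    | _              | ⊥₋    | _             = refl
    ... | ⊥₋    | zeroPoly p≋[]  | [ _ ] | hasDegree hq  =
      contradiction (RX.trans (RX.sym p≋q) p≋[]) (HasDegree⇒≉0 hq)
    ... | [ _ ] | hasDegree hp   | ⊥₋    | zeroPoly q≋[] =
      contradiction (RX.trans p≋q q≋[]) (HasDegree⇒≉0 hp)
    ... | [ d ] | hasDegree hp   | [ e ] | hasDegree hq
      with refl ← HasDegree-unique (HasDegree-resp-≋ p≋q hp) hq =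
        cong (d +_) (N.size-cong (coeff-≈ p≋q d))

    size-* : ∀ {p q} → ¬ p ≋ [] → ¬ q ≋ [] → size (p *ₚ q) ≡ size p + size q
    size-* {p} {q} p≉0 q≉0 with ≉0⇒HasDegree p≉0 | ≉0⇒HasDegree q≉0
    ... | d , hp | e , hq = begin
      size (p *ₚ q)                                           ≡⟨ size-HasDegree (HasDegree-*ₚ R-domain hp hq) ⟩
      d + e + N.size (coeff (p *ₚ q) (d + e))
        ≡⟨ cong (d + e +_) (trans (N.size-cong (coeff-*ₚ-top p q (bounded hp) (bounded hq)))
             (N.size-* (leading≉0 hp) (leading≉0 hq))) ⟩
      (d + e) + (N.size (coeff p d) + N.size (coeff q e))     ≡⟨ interchange d e _ _ ⟩
      (d + N.size (coeff p d)) + (e + N.size (coeff q e))     ≡⟨ cong₂ _+_ (size-HasDegree hp) (size-HasDegree hq) ⟨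
      size p + size q                                         ∎
      where
      open ≡-Reasoning
      open CommutativeSemigroupProperties ℕₚ.+-commutativeSemigroup using (interchange)

    size≡0⇒unit : ∀ {p} → ¬ p ≋ [] → size p ≡ 0 → p ∣ const R.1#
    size≡0⇒unit {p} p≉0 |p|≡0 with ≉0⇒HasDegree p≉0
    ... | d , hp with refl ← ℕₚ.m+n≡0⇒m≡0 d (trans (sym (size-HasDegree hp)) |p|≡0) =
      const-unit (bounded hp) (N.size≡0⇒unit (leading≉0 hp) (trans (sym (size-HasDegree hp)) |p|≡0))

module _ {c ℓ} (K : Field c ℓ) where
  private module K = Field K

  -- The zero norm suffices because every nonzero element is a unit; it starts the induction on the
  -- number of variables.
  field-normedDomain : NormedDomain K.decCommutativeRing
  field-normedDomain = record
    { isDomain    = record { 1≉0 = K.1≉0 ; *-nonzero = *-nonzero }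
    ; size        = λ _ → 0
    ; size-cong   = λ _ → refl
    ; size-*      = λ _ _ → refl
    ; size≡0⇒unit = λ {x} x≉0 _ → let y , xy≈1 = K.inverse x x≉0 in y , K.trans (K.*-comm y x) xy≈1
    }
    where
    *-nonzero : ∀ {x y} → x K.≉ K.0# → y K.≉ K.0# → x K.* y K.≉ K.0#
    *-nonzero {x} {y} x≉0 y≉0 xy≈0 with z , xz≈1 ← K.inverse x x≉0 = y≉0 (begin
      y                    ≈⟨ K.*-identityˡ y ⟨
      K.1# K.* y           ≈⟨ K.*-congʳ xz≈1 ⟨
      (x K.* z) K.* y      ≈⟨ K.*-congʳ (K.*-comm x z) ⟩
      (z K.* x) K.* y      ≈⟨ K.*-assoc z x y ⟩
      z K.* (x K.* y)      ≈⟨ K.*-congˡ xy≈0 ⟩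
      z K.* K.0#           ≈⟨ K.zeroʳ z ⟩
      K.0#                 ∎)
      where open SetoidReasoning K.setoid

  polynomials-normedDomain : ∀ m → NormedDomain (Polynomials K m)
  polynomials-normedDomain zero    = field-normedDomain
  polynomials-normedDomain (suc m) =
    PolyProperties.R[X]-normedDomain (Polynomials K m) (polynomials-normedDomain m)

-- Bivariate polynomials and their leading coefficient in y.

-- Y is R[y] and X is R[y][x].
module Bivariate {c ℓ} (R : DecCommutativeRing c ℓ) (R-normedDomain : NormedDomain R) where

  private
    module R = DecCommutativeRing R
    module Y = Poly R
    module X = Poly Y.R[X]
    module B = DecCommutativeRing Y.R[X]
    module P = DecCommutativeRing X.R[X]
    module YP = PolyProperties R
    module XP = PolyProperties Y.R[X]
  open NormedDomain R-normedDomain using () renaming (isDomain to R-domain)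
  open IsDomain R-domain
  open YP using (HasDegree; mkDegree; leading≉0; bounded)

  B-domain : IsDomain Y.R[X]
  B-domain = YP.R[X]-isDomain R-domain

  P-domain : IsDomain X.R[X]
  P-domain = XP.R[X]-isDomain B-domain

  P-normedDomain : NormedDomain X.R[X]
  P-normedDomain = XP.R[X]-normedDomain (YP.R[X]-normedDomain R-normedDomain)

  private
    module B-domain = IsDomain B-domain
    module P-domain = IsDomain P-domain

  YBounded : P.Carrier → ℕ → Set ℓ
  YBounded p d = ∀ i → YP.Bounded (X.coeff p i) d

  -- The result lies in R[x]; its type is that of R[y] only because univariate
  -- polynomials do not record the name of their variable.
  yCoeff : ℕ → P.Carrier → B.Carrier
  yCoeff d = map (λ b → Y.coeff b d)

  coeff-yCoeff : ∀ d p i → Y.coeff (yCoeff d p) i ≡ Y.coeff (X.coeff p i) d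
  coeff-yCoeff d []      i       = refl
  coeff-yCoeff d (b ∷ p) zero    = refl
  coeff-yCoeff d (b ∷ p) (suc i) = coeff-yCoeff d p i

  yCoeff-≋ : ∀ {d p q} → (∀ i → Y.coeff (X.coeff p i) d R.≈ Y.coeff q i) → yCoeff d p Y.≋ q
  yCoeff-≋ {d} {p} {q} e = Y.mk≋ λ i → subst (R._≈ Y.coeff q i) (sym (coeff-yCoeff d p i)) (e i)

  yCoeff-≈ : ∀ {d p q} → yCoeff d p Y.≋ q → ∀ i → Y.coeff (X.coeff p i) d R.≈ Y.coeff q i
  yCoeff-≈ {d} {p} {q} e i = subst (R._≈ Y.coeff q i) (coeff-yCoeff d p i) (Y.coeff-≈ e i)

  yCoeff-cong : ∀ {d p q} → p P.≈ q → yCoeff d p Y.≋ yCoeff d q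
  yCoeff-cong {d} {p} {q} p≈q = yCoeff-≋ {d} {p} λ i →
    R.trans (Y.coeff-≈ (X.coeff-≈ p≈q i) d) (R.reflexive (sym (coeff-yCoeff d q i)))

  coeff²-+ : ∀ p q i k → Y.coeff (X.coeff (p P.+ q) i) k R.≈
             Y.coeff (X.coeff p i) k R.+ Y.coeff (X.coeff q i) k
  coeff²-+ p q i k = R.trans (Y.coeff-≈ (X.coeff-+ p q i) k) (Y.coeff-+ (X.coeff p i) _ k)

  YBounded-* : ∀ p q {d e} → YBounded p d → YBounded q e → YBounded (p P.* q) (d + e)
  YBounded-* []      q bp bq i d+e<k = R.refl
  YBounded-* (b ∷ p) q {d} {e} bp bq i {k} d+e<k = begin
    Y.coeff (X.coeff (b X.· q X.+ₚ ([] ∷ (p P.* q))) i) k   ≈⟨ coeff²-+ (b X.· q) _ i k ⟩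
    Y.coeff (X.coeff (b X.· q) i) k R.+ Y.coeff (X.coeff ([] ∷ (p P.* q)) i) k
      ≈⟨ R.+-cong (R.trans (Y.coeff-≈ (X.coeff-· b q i) k) (YP.*ₚ-bounded b _ (bp 0) (bq i) d+e<k))
                  (shifted i) ⟩
    R.0# R.+ R.0#                                           ≈⟨ R.+-identityʳ _ ⟩
    R.0#                                                    ∎
    where
    open SetoidReasoning R.setoid
    shifted : ∀ i → Y.coeff (X.coeff ([] ∷ (p P.* q)) i) k R.≈ R.0#
    shifted zero    = R.refl
    shifted (suc i) = YBounded-* p q (bp ∘ suc) bq i d+e<k

  -- Induction on `p` as a polynomial in x: its first coefficient contributes through the
  -- top-coefficient rule in R[y], the rest through a shift by one power of x. For attained bounds
  -- this says that the leading coefficient in y is multiplicative.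
  yCoeff-* : ∀ p q {d e} → YBounded p d → YBounded q e →
             yCoeff (d + e) (p P.* q) Y.≋ yCoeff d p B.* yCoeff e q
  yCoeff-* []      q _ _ = B.refl
  yCoeff-* (b ∷ p) q {d} {e} bp bq = yCoeff-≋ {d + e} {(b ∷ p) P.* q} λ i → begin
    Y.coeff (X.coeff (b X.· q X.+ₚ ([] ∷ (p P.* q))) i) (d + e)   ≈⟨ coeff²-+ (b X.· q) _ i (d + e) ⟩
    Y.coeff (X.coeff (b X.· q) i) (d + e) R.+ Y.coeff (X.coeff ([] ∷ (p P.* q)) i) (d + e)
      ≈⟨ R.+-cong (scaled i) (shifted i) ⟩
    Y.coeff (Y.coeff b d Y.· yCoeff e q) i R.+ Y.coeff (R.0# ∷ (yCoeff d p B.* yCoeff e q)) i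
      ≈⟨ Y.coeff-+ (Y.coeff b d Y.· yCoeff e q) _ i ⟨
    Y.coeff (yCoeff d (b ∷ p) B.* yCoeff e q) i                   ∎
    where
    open SetoidReasoning R.setoid
    scaled : ∀ i → Y.coeff (X.coeff (b X.· q) i) (d + e) R.≈ Y.coeff (Y.coeff b d Y.· yCoeff e q) i
    scaled i = begin
      Y.coeff (X.coeff (b X.· q) i) (d + e)         ≈⟨ Y.coeff-≈ (X.coeff-· b q i) (d + e) ⟩
      Y.coeff (b B.* X.coeff q i) (d + e)           ≈⟨ YP.coeff-*ₚ-top b _ (bp 0) (bq i) ⟩
      Y.coeff b d R.* Y.coeff (X.coeff q i) e       ≡⟨ cong (Y.coeff b d R.*_) (coeff-yCoeff e q i) ⟨
      Y.coeff b d R.* Y.coeff (yCoeff e q) i        ≈⟨ Y.coeff-· (Y.coeff b d) (yCoeff e q) i ⟨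
      Y.coeff (Y.coeff b d Y.· yCoeff e q) i        ∎
    shifted : ∀ i → Y.coeff (X.coeff ([] ∷ (p P.* q)) i) (d + e) R.≈
                    Y.coeff (R.0# ∷ (yCoeff d p B.* yCoeff e q)) i
    shifted zero    = R.refl
    shifted (suc i) = yCoeff-≈ {d + e} {p P.* q} (yCoeff-* p q (bp ∘ suc) bq) i

  -- The numerical invariants of a bivariate polynomial.

  record Shape (p : P.Carrier) (m d j : ℕ) : Set (c ⊔ˡ ℓ) where
    constructor mkShape
    field
      xDegree   : XP.HasDegree p m
      yBounded  : YBounded p d
      -- This makes the coefficient of y to the power `d` nonzero, so `d` is the exact degree in y.
      topDegree : HasDegree (yCoeff d p) j
  open Shape

  Shape-* : ∀ {p q m d j m′ d′ j′} → Shape p m d j → Shape q m′ d′ j′ →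
            Shape (p P.* q) (m + m′) (d + d′) (j + j′)
  Shape-* {p} {q} sp sq = mkShape
    (XP.HasDegree-*ₚ B-domain (xDegree sp) (xDegree sq))
    (YBounded-* p q (yBounded sp) (yBounded sq))
    (YP.HasDegree-resp-≋ (B.sym (yCoeff-* p q (yBounded sp) (yBounded sq)))
      (YP.HasDegree-*ₚ R-domain (topDegree sp) (topDegree sq)))

  Shape-resp-≈ : ∀ {p q m d j} → p P.≈ q → Shape p m d j → Shape q m d j
  Shape-resp-≈ p≈q sp = mkShape
    (XP.HasDegree-resp-≋ p≈q (xDegree sp))
    (λ i d<k → R.trans (R.sym (Y.coeff-≈ (X.coeff-≈ p≈q i) _)) (yBounded sp i d<k))
    (YP.HasDegree-resp-≋ (yCoeff-cong p≈q) (topDegree sp))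

  topCoeff≉0 : ∀ {p m d j} → Shape p m d j → Y.coeff (X.coeff p j) d R.≉ R.0#
  topCoeff≉0 {p} {d = d} {j} sp = leading≉0 (topDegree sp) ∘ R.trans (R.reflexive (coeff-yCoeff d p j))

  topDegree≤xDegree : ∀ {p m d j} → Shape p m d j → j ≤ m
  topDegree≤xDegree {p} {d = d} sp = XP.coeff≉0⇒≤ {p} (XP.bounded (xDegree sp))
    λ pⱼ≈0 → topCoeff≉0 sp (Y.coeff-≈ pⱼ≈0 d)

  -- The nonzero coefficient at the top of one shape must respect the y-bound of the other, so `d`
  -- and `d′` agree; the rest is uniqueness of degrees. It identifies the shape computed from
  -- factors with the one already given for the product.
  Shape-unique : ∀ {p m d j m′ d′ j′} → Shape p m d j → Shape p m′ d′ j′ →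
                 m ≡ m′ × d ≡ d′ × j ≡ j′
  Shape-unique {p} {d = d} {j} {d′ = d′} {j′} s s′ with d≡d′
    where
    d≡d′ : d ≡ d′
    d≡d′ = ℕₚ.≤-antisym
      (YP.coeff≉0⇒≤ {X.coeff p j} (yBounded s′ j) (topCoeff≉0 s))
      (YP.coeff≉0⇒≤ {X.coeff p j′} (yBounded s j′) (topCoeff≉0 s′))
  ... | refl = XP.HasDegree-unique (xDegree s) (xDegree s′) , refl
             , YP.HasDegree-unique (topDegree s) (topDegree s′)

  ∃-YBounded : ∀ p → ∃ (YBounded p)
  ∃-YBounded [] = 0 , λ _ _ → R.refl
  ∃-YBounded (b ∷ p) with d , bp ← ∃-YBounded p = length b ⊔ d , λ where
    zero    <k → YP.length-bounded b (ℕₚ.≤-<-trans (ℕₚ.m≤m⊔n (length b) d) <k)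
    (suc i) <k → bp i (ℕₚ.≤-<-trans (ℕₚ.m≤n⊔m (length b) d) <k)

  -- Lowers the bound while the coefficient at it vanishes. This stops by `d = 0` at the latest,
  -- where a vanishing coefficient would make `p` zero.
  descend : ∀ d {p} → p P.≉ P.0# → YBounded p d → ∃ λ e → YBounded p e × yCoeff e p B.≉ B.0#
  descend d {p} p≉0 bp with yCoeff d p B.≟ B.0#
  descend d       {p} p≉0 bp | no  top≉0 = d , bp , top≉0
  descend zero    {p} p≉0 bp | yes top≈0 = contradiction
    (X.mk≋ λ i → Y.mk≋ λ { zero → yCoeff-≈ {0} {p} top≈0 i ; (suc _) → bp i z<s }) p≉0
  descend (suc d) {p} p≉0 bp | yes top≈0 = descend d p≉0 bp′
    where
    bp′ : YBounded p d
    bp′ i d<k with ℕₚ.m≤n⇒m<n∨m≡n d<k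
    ... | inj₁ 1+d<k = bp i 1+d<k
    ... | inj₂ refl  = yCoeff-≈ {suc d} {p} top≈0 i

  ≉0⇒Shape : ∀ {p} → p P.≉ P.0# → ∃ λ m → ∃ λ d → ∃ λ j → Shape p m d j
  ≉0⇒Shape {p} p≉0 with XP.≉0⇒HasDegree p≉0 | descend (proj₁ (∃-YBounded p)) p≉0 (proj₂ (∃-YBounded p))
  ... | m , hp | d , bp , top≉0 with YP.≉0⇒HasDegree top≉0
  ... | j , ht = m , d , j , mkShape hp bp ht

  -- Counting the factors of positive x-degree.

  module FactorCount {f : P.Carrier} {n d j : ℕ} (f-shape : Shape f n d j)
    (lc-constant : YP.Bounded (X.coeff f n) 0)
    (f₀≉0 : X.coeff f 0 B.≉ B.0#)
    (top-monomial : ∀ {i} → i ≢ j → Y.coeff (X.coeff f i) d R.≈ R.0#)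
    where

    f≉0 : f P.≉ P.0#
    f≉0 = XP.HasDegree⇒≉0 (xDegree f-shape)

    -- If `k = m`, the contradiction appears in the cofactor. The leading coefficients in y of `p`
    -- and `q` multiply to a monomial of degree `k + k′` in x; the first has a nonzero constant
    -- term, so the second vanishes below `k + k′`.
    factor-topDegree<xDegree : ∀ {p q m e k} → p P.* q P.≈ f → Shape p m e k → 0 < m → k < m
    factor-topDegree<xDegree {p} {q} {m} {e} {k} pq≈f sp 0<m
      with ℕₚ.m≤n⇒m<n∨m≡n (topDegree≤xDegree sp)
    ... | inj₁ k<m  = k<m
    ... | inj₂ refl
      with m′ , e′ , k′ , sq ← ≉0⇒Shape (P-domain.*≉0⇒ʳ≉0 {p} {q} (f≉0 ∘ P.trans (P.sym pq≈f)))
      with refl , refl , refl ← Shape-unique (Shape-resp-≈ pq≈f (Shape-* sp sq)) f-shape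
      -- Since `0 < k`, the range of vanishing includes the degree `k′` itself.
      = contradiction (q-vanishes (ℕₚ.m<n+m k′ 0<m)) (leading≉0 (topDegree sq))
      where
      -- As `k = m`, the y-degree `e` of `p` is attained in its leading x-coefficient.
      lc-p-degree : HasDegree (X.coeff p k) e
      lc-p-degree = mkDegree (topCoeff≉0 sp) (yBounded sp k)
      lc-q-degree : ∃ (HasDegree (X.coeff q m′))
      lc-q-degree = YP.≉0⇒HasDegree (XP.leading≉0 (xDegree sq))
      lc-f≈ : X.coeff f (k + m′) B.≈ X.coeff p k B.* X.coeff q m′
      lc-f≈ = B.trans (B.sym (X.coeff-≈ pq≈f (k + m′)))
        (XP.coeff-*ₚ-top p q (XP.bounded (xDegree sp)) (XP.bounded (xDegree sq)))
      -- The y-degree of the leading coefficient of `f` is `e` plus that of `q`'s leading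
      -- coefficient, and it is 0.
      e≡0 : e ≡ 0
      e≡0 = ℕₚ.m+n≡0⇒m≡0 e (ℕₚ.n≤0⇒n≡0 (YP.coeff≉0⇒≤ {X.coeff f (k + m′)} lc-constant
        (leading≉0 (YP.HasDegree-resp-≋ (B.sym lc-f≈)
          (YP.HasDegree-*ₚ R-domain lc-p-degree (proj₂ lc-q-degree))))))
      p₀≉0 : X.coeff p 0 B.≉ B.0#
      p₀≉0 = B-domain.*≉0⇒ˡ≉0 {X.coeff p 0} {X.coeff q 0}
        (f₀≉0 ∘ B.trans (B.trans (B.sym (X.coeff-≈ pq≈f 0)) (XP.coeff-*ₚ-0 p q)))
      -- With `e = 0` the constant term of `p` is free of y, so it is determined by its coefficient
      -- at `e`.
      top-p₀≉0 : Y.coeff (yCoeff e p) 0 R.≉ R.0#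
      top-p₀≉0 t≈0 = p₀≉0 (Y.mk≋ λ
        { zero    → subst (λ e → Y.coeff (X.coeff p 0) e R.≈ R.0#) e≡0
                      (R.trans (R.reflexive (sym (coeff-yCoeff e p 0))) t≈0)
        ; (suc _) → yBounded sp 0 (subst (_< _) (sym e≡0) z<s) })
      top-f≋ : yCoeff (e + e′) f Y.≋ yCoeff e p B.* yCoeff e′ q
      top-f≋ = B.trans (yCoeff-cong (P.sym pq≈f)) (yCoeff-* p q (yBounded sp) (yBounded sq))
      q-vanishes : ∀ {i} → i < k + k′ → Y.coeff (yCoeff e′ q) i R.≈ R.0#
      q-vanishes = YP.*ₚ-vanishes-below R-domain (yCoeff e p) (yCoeff e′ q) top-p₀≉0 λ {i} i<j →
        R.trans (R.sym (Y.coeff-≈ top-f≋ i))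
          (R.trans (R.reflexive (coeff-yCoeff (e + e′) f i)) (top-monomial (ℕₚ.<⇒≢ i<j)))

    count : List P.Carrier → ℕ
    count ps = length (filter X.nonconstant? ps)

    -- A nonconstant factor increases `m - k` by at least 1 and any other factor does not lower it;
    -- the additive form avoids truncated subtraction. The cofactor `q` collects the factors already
    -- passed, so that each `p` is still known to divide `f`.
    count+topDegree≤xDegree : ∀ ps {q m e k} → q P.* foldr P._*_ P.1# ps P.≈ f →
                              Shape (foldr P._*_ P.1# ps) m e k → count ps + k ≤ m
    count+topDegree≤xDegree [] _ s = topDegree≤xDegree s
    count+topDegree≤xDegree (p ∷ ps) {q} q*p*Π≈f s
      with m₁ , e₁ , k₁ , s₁ ← ≉0⇒Shape (P-domain.*≉0⇒ˡ≉0 {p} {foldr P._*_ P.1# ps} (XP.HasDegree⇒≉0 (xDegree s)))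
      with m₂ , e₂ , k₂ , s₂ ← ≉0⇒Shape (P-domain.*≉0⇒ʳ≉0 {p} {foldr P._*_ P.1# ps} (XP.HasDegree⇒≉0 (xDegree s)))
      with refl , refl , refl ← Shape-unique s (Shape-* s₁ s₂)
      with rest ← count+topDegree≤xDegree ps {q P.* p} (P.trans (P.*-assoc q p _) q*p*Π≈f) s₂
      with X.nonconstant? p
    ... | yes nc = begin
      suc (count ps) + (k₁ + k₂)   ≡⟨ cong suc (x∙yz≈y∙xz (count ps) k₁ k₂) ⟩
      suc k₁ + (count ps + k₂)     ≤⟨ ℕₚ.+-mono-≤ k₁<m₁ rest ⟩
      m₁ + m₂                      ∎
      where
      open ℕₚ.≤-Reasoning
      open CommutativeSemigroupProperties ℕₚ.+-commutativeSemigroup using (x∙yz≈y∙xz)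
      Π = foldr P._*_ P.1# ps
      k₁<m₁ : k₁ < m₁
      k₁<m₁ = factor-topDegree<xDegree {p} {Π P.* q}
        (P.trans (P.sym (P.*-assoc p Π q)) (P.trans (P.*-comm (p P.* Π) q) q*p*Π≈f))
        s₁ (XP.Nonconstant⇒positive (xDegree s₁) nc)
    ... | no _ = begin
      count ps + (k₁ + k₂)   ≡⟨ x∙yz≈y∙xz (count ps) k₁ k₂ ⟩
      k₁ + (count ps + k₂)   ≤⟨ ℕₚ.+-mono-≤ (topDegree≤xDegree s₁) rest ⟩
      m₁ + m₂                ∎
      where
      open ℕₚ.≤-Reasoning
      open CommutativeSemigroupProperties ℕₚ.+-commutativeSemigroup using (x∙yz≈y∙xz)

    count≤ : ∀ ps → f P.≈ foldr P._*_ P.1# ps → count ps ≤ n ∸ j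
    count≤ ps f≈Π = ℕₚ.m+n≤o⇒m≤o∸n (count ps) (count+topDegree≤xDegree ps {P.1#}
      (P.trans (P.*-identityˡ _) (P.sym f≈Π)) (Shape-resp-≈ f≈Π f-shape))

    module _ (j<n : j < n) where

      private
        0<n : 0 < n
        0<n = ℕₚ.≤-<-trans z≤n j<n
        f-nonconstant : X.Nonconstant f
        f-nonconstant = XP.positive⇒Nonconstant (xDegree f-shape) 0<n

      factorisation-exists : ¬ ¬ ∃ λ ps → X.IsFactorisation f ps
      factorisation-exists = NormedDomain.factorise P-normedDomain _ (ℕₚ.n<1+n _) f≉0
        (XP.positive-degree⇒∤1 B-domain (xDegree f-shape) 0<n)

      primitive⇒length≤ : ∀ ps → X.IsFactorisation f ps → X.Primitive f → length ps ≤ n ∸ j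
      primitive⇒length≤ ps (ps-irr , f≈Π) f-prim =
        subst (_≤ n ∸ j) (cong length (filter-all X.nonconstant? all-nonconstant)) (count≤ ps f≈Π)
        where
        all-nonconstant : All X.Nonconstant ps
        all-nonconstant = XP.primitive-factors-nonconstant f-prim f≉0 ps ps-irr
          (P.1# , P.trans (P.*-identityˡ _) (P.sym f≈Π))

      -- `count≤` asks no irreducibility of the listed factors, so it applies to `g` and `h`
      -- directly: if both were nonconstant, the count 2 would exceed `n ∸ j`, which is 1.
      irreducibleInX : j ≡ n ∸ 1 → X.IrreducibleInX f
      irreducibleInX j≡n∸1 = f-nonconstant , split
        where
        n∸j≤1 : n ∸ j ≤ 1
        n∸j≤1 = ℕₚ.≤-reflexive (trans (cong (n ∸_) j≡n∸1) (ℕₚ.m∸[m∸n]≡n 0<n))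
        split : ∀ g h → f P.≈ g P.* h → ¬ X.Nonconstant g ⊎ ¬ X.Nonconstant h
        split g h f≈gh with X.nonconstant? g | X.nonconstant? h
        ... | no ¬nc | _      = inj₁ ¬nc
        ... | yes _  | no ¬nc = inj₂ ¬nc
        ... | yes gc | yes hc = contradiction
          (subst (_≤ 1) (cong length (filter-all X.nonconstant? {g ∷ h ∷ []} (gc ∷ hc ∷ [])))
            (ℕₚ.≤-trans (count≤ (g ∷ h ∷ []) f≈gh1) n∸j≤1))
          λ { (s≤s ()) }
          where
          f≈gh1 = P.trans f≈gh (P.*-congˡ {g} (P.sym (P.*-identityʳ h)))

  -- From a dominant coefficient to the shape of f.

  module DominantCoefficient {n : ℕ} {f : P.Carrier}
    (a : Fin (suc n) → B.Carrier) (f≈a : f P.≈ tabulate a)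
    (lc-constant : ∃ λ r → a (fromℕ n) B.≈ Y.const r)
    (a₀aₙ≉0 : a zero B.* a (fromℕ n) B.≉ B.0#)
    (j : Fin n) {d : ℕ} (aⱼ-degree : HasDegree (a (inject₁ j)) d)
    (dominant : ∀ i → i ≢ inject₁ j → Y.deg (a i) <₋ [ d ])
    where

    coeff-f : ∀ i → X.coeff f (toℕ i) B.≈ a i
    coeff-f i = B.trans (X.coeff-≈ f≈a (toℕ i)) (B.reflexive (XP.coeff-tabulate a i))

    coeff-f-n : X.coeff f n B.≈ a (fromℕ n)
    coeff-f-n = subst (λ k → X.coeff f k B.≈ a (fromℕ n)) (toℕ-fromℕ n) (coeff-f (fromℕ n))

    coeff-f-j : X.coeff f (toℕ j) B.≈ a (inject₁ j)
    coeff-f-j = subst (λ k → X.coeff f k B.≈ a (inject₁ j)) (toℕ-inject₁ j) (coeff-f (inject₁ j))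

    coeff-f-> : ∀ {i} → n < i → X.coeff f i B.≈ B.0#
    coeff-f-> n<i = B.trans (X.coeff-≈ f≈a _) (B.reflexive (XP.coeff-tabulate-≥ a n<i))

    f₀≉0 : X.coeff f 0 B.≉ B.0#
    f₀≉0 = B-domain.*≉0⇒ˡ≉0 {a zero} {a (fromℕ n)} a₀aₙ≉0 ∘ B.trans (B.sym (coeff-f zero))

    lc-f-constant : YP.Bounded (X.coeff f n) 0
    lc-f-constant {suc k} _ = Y.coeff-≈ (B.trans coeff-f-n (proj₂ lc-constant)) (suc k)

    -- Used at both ends of `d ≤ k`: `k = d` makes the coefficient of y to the power `d` a monomial
    -- in x, and `k > d` bounds the y-degree of `f`.
    coeff-f-≢j : ∀ {i k} → i ≢ toℕ j → d ≤ k → Y.coeff (X.coeff f i) k R.≈ R.0#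
    coeff-f-≢j {i} {k} i≢j d≤k with i ℕₚ.≤? n
    ... | no i≰n  = Y.coeff-≈ (coeff-f-> (ℕₚ.≰⇒> i≰n)) k
    ... | yes i≤n = R.trans
      (Y.coeff-≈ (subst (λ i → X.coeff f i B.≈ a i′) (toℕ-fromℕ< (s≤s i≤n)) (coeff-f i′)) k)
      (YP.deg<⇒vanishes {a i′} (dominant i′ i′≢j) d≤k)
      where
      i′ = fromℕ< (s≤s i≤n)
      i′≢j : i′ ≢ inject₁ j
      i′≢j eq = i≢j (trans (sym (toℕ-fromℕ< (s≤s i≤n))) (trans (cong toℕ eq) (toℕ-inject₁ j)))

    f-shape : Shape f n d (toℕ j)
    f-shape = mkShape
      (XP.mkDegree (B-domain.*≉0⇒ʳ≉0 {a zero} {a (fromℕ n)} a₀aₙ≉0 ∘ B.trans (B.sym coeff-f-n)) coeff-f->)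
      f-yBounded
      (mkDegree
        (λ t≈0 → leading≉0 aⱼ-degree
          (R.trans (R.sym (Y.coeff-≈ coeff-f-j d)) (R.trans (coeff-t (toℕ j)) t≈0)))
        (λ {i} j<i → R.trans (R.sym (coeff-t i)) (coeff-f-≢j (ℕₚ.>⇒≢ j<i) ℕₚ.≤-refl)))
      where
      coeff-t : ∀ i → Y.coeff (X.coeff f i) d R.≈ Y.coeff (yCoeff d f) i
      coeff-t i = R.reflexive (sym (coeff-yCoeff d f i))
      f-yBounded : YBounded f d
      f-yBounded i d<k with i ℕₚ.≟ toℕ j
      ... | yes refl = R.trans (Y.coeff-≈ coeff-f-j _) (bounded aⱼ-degree d<k)
      ... | no i≢j   = coeff-f-≢j i≢j (ℕₚ.<⇒≤ d<k)

    top-monomial : ∀ {i} → i ≢ toℕ j → Y.coeff (X.coeff f i) d R.≈ R.0#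
    top-monomial i≢j = coeff-f-≢j i≢j ℕₚ.≤-refl

  -- The factor bound over a normed domain, and its specialisation to K.

  dominantCoefficient-factors : ∀ {n f} (a : Fin (suc n) → B.Carrier) →
    f P.≈ X.sum (λ i → X.const (a i) P.* (X.X X.^ toℕ i)) →
    (∃ λ r → a (fromℕ n) B.≈ Y.const r) →
    a zero B.* a (fromℕ n) B.≉ B.0# →
    (j : Fin n) →
    (∀ i → i ≢ inject₁ j → Y.deg (a i) <₋ Y.deg (a (inject₁ j))) →
    (¬ ¬ ∃ λ ps → X.IsFactorisation f ps)
    × (∀ ps → X.IsFactorisation f ps →
         length (filter X.nonconstant? ps) ≤ n ∸ toℕ j
         × (X.Primitive f → length ps ≤ n ∸ toℕ j))
    × (toℕ j ≡ n ∸ 1 → X.IrreducibleInX f × (X.Primitive f → X.Irreducible f))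
  dominantCoefficient-factors {n} {f} a f≈Σ lc-constant a₀aₙ≉0 j dominant =
      factorisation-exists (toℕ<n j)
    , (λ ps fac → count≤ ps (proj₂ fac) , primitive⇒length≤ (toℕ<n j) ps fac)
    , λ j≡n∸1 → let irr = irreducibleInX (toℕ<n j) j≡n∸1 in
        irr , λ f-prim → XP.primitive-IrreducibleInX⇒Irreducible B-domain f-prim irr
    where
    aⱼ-degree : ∃ (HasDegree (a (inject₁ j)))
    -- Index `n` differs from `j`, so the degree of the coefficient at `j` strictly exceeds another
    -- degree and cannot be that of the zero polynomial.
    aⱼ-degree = YP.<₋deg⇒HasDegree (dominant (fromℕ n) fromℕ≢inject₁)
    open DominantCoefficient {f = f} a (P.trans f≈Σ (XP.sum-monomials a)) lc-constant a₀aₙ≉0 j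
      (proj₂ aⱼ-degree)
      (λ i i≢j → subst (Y.deg (a i) <₋_) (YP.HasDegree⇒deg≡ (proj₂ aⱼ-degree)) (dominant i i≢j))
    open FactorCount f-shape lc-f-constant f₀≉0 top-monomial

-- Nonzero elements of the coefficient ring count as constants, so the bound concerns factors of
-- positive degree in the last variable. For primitive `f` every irreducible factor is of this kind,
-- and the whole list is bounded.
theorem9 : ∀ {c ℓ} (K : Field c ℓ) (t : ℕ) →
  let s = 3 + t
      K[x₁⋯xₛ₋₂] = Polynomials K (s ∸ 2)
      K[x₁⋯xₛ₋₁] = Polynomials K (s ∸ 1)
      K[x₁⋯xₛ]   = Polynomials K s
      module A = DecCommutativeRing K[x₁⋯xₛ₋₂]
      module B = DecCommutativeRing K[x₁⋯xₛ₋₁]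
      module P = DecCommutativeRing K[x₁⋯xₛ]
      module A[xₛ₋₁] = Poly K[x₁⋯xₛ₋₂]
      module B[xₛ] = Poly K[x₁⋯xₛ₋₁]
  in
  (n : ℕ) → 2 ≤ n →
  (f : P.Carrier) (a : Fin (suc n) → B.Carrier) →
  f P.≈ B[xₛ].sum (λ i → B[xₛ].const (a i) P.* (B[xₛ].X B[xₛ].^ toℕ i)) →
  (∃ λ (b : A.Carrier) → a (fromℕ n) B.≈ A[xₛ₋₁].const b) →
  (a zero B.* a (fromℕ n)) B.≉ B.0# →
  (j : Fin n) →
  (∀ i → i ≢ inject₁ j → A[xₛ₋₁].deg (a i) <₋ A[xₛ₋₁].deg (a (inject₁ j))) →
  (¬ ¬ (∃ λ ps → B[xₛ].IsFactorisation f ps))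
  × (∀ ps → B[xₛ].IsFactorisation f ps →
       length (filter B[xₛ].nonconstant? ps) ≤ n ∸ toℕ j
       × (B[xₛ].Primitive f → length ps ≤ n ∸ toℕ j))
  × (toℕ j ≡ n ∸ 1 →
       B[xₛ].IrreducibleInX f × (B[xₛ].Primitive f → B[xₛ].Irreducible f))
theorem9 K t n 2≤n f a =
  -- Since `s ∸ 2` is `suc t`, R is the polynomial ring in `suc t` variables, and y and x are the
  -- last two of the `s` variables.
  Bivariate.dominantCoefficient-factors
    (Polynomials K (suc t)) (polynomials-normedDomain K (suc t)) a
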